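{- Let $R_n$ be the random variable counting the number of alternating runs in an $n$-permutation chosen uniformly at random amongst all $n$-permutations. Then for $n\ge 2$ we have $$\mathbb{E}\left(1.784^{R_n}\right)=\mathcal{O}\left(1.515^n\right).$$
   Context: An $n$-permutation is a bijection $\pi:\{1,\dots,n\}\to\{1,\dots,n\}$, viewed as the sequence $\pi(1),\dots,\pi(n)$. Alternating runs (for $n\ge2$): a valley of $\pi$ is an element $\pi(i)$ smaller than both of its neighbours, a peak is an element larger than both of its neighbours; for the first and last element only the existing neighbour is compared. Valleys and peaks are the local extrema; the first and last elements of $\pi$ are always local extrema. The first alternating run consists of the elements from the first element up to and including the second local extremum; the second run starts with the following element and ends with the third local extremum, and so on. Thus every element lies in exactly one run, and the number of alternating runs is the number of local extrema minus $1$. Example: $53142$ has the three runs $531\,|\,4\,|\,2$. -}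

module Defs where

open import Data.Bool.Base using (if_then_else_)
open import Data.Fin.Base using (Fin; toℕ; _<_)
open import Data.Fin.Properties using (all?; any?; _<?_) renaming (_≟_ to _≟ᶠ_)
open import Data.Integer.Base using (+_)
open import Data.List.Base
  using (List; []; _∷_; length; map; foldr; filter; allFin; cartesianProductWith)
open import Data.List.Membership.Propositional using (_∈_)
open import Data.List.Membership.Propositional.Properties
  using (∈-allFin; ∈-filter⁺; ∈-cartesianProductWith⁺)
open import Data.List.Relation.Unary.Any using (here; there)
open import Data.Nat.Base as ℕ using (ℕ; zero; suc)
open import Data.Nat.Properties using (_≟_)
open import Data.Product.Base using (_,_; proj₁; proj₂)
open import Data.Rational.Base using (ℚ; 0ℚ; _+_; _*_; _/_; +-*-rawSemiring)
open import Data.Sum.Base using (_⊎_)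
open import Data.Vec.Base as Vec using (Vec; lookup)
open import Data.Vec.Properties using (lookup-allFin)
open import Function.Definitions using (Injective; Surjective; Bijective)
open import Level using (0ℓ)
open import Relation.Binary.PropositionalEquality
  using (_≡_; refl; sym; trans; cong)
open import Relation.Nullary.Decidable
  using (Dec; does; map′; _×-dec_; _⊎-dec_; _→-dec_)
open import Relation.Unary using (Pred; Decidable)

open import Algebra.Definitions.RawSemiring +-*-rawSemiring public using (_^_)

private
  variable
    A : Set
    n : ℕ

-- An n-permutation is a word π(1) … π(n) whose associated map
-- `lookup π : Fin n → Fin n` is bijective; {1,…,n} is represented by
-- `Fin n`, so positions and values are both shifted down by one.

IsPermutation : Vec (Fin n) n → Set
IsPermutation π = Bijective _≡_ _≡_ (lookup π)

isPermutation? : Decidable (IsPermutation {n})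
isPermutation? π = injective? ×-dec surjective?
  where
  injective? : Dec (Injective _≡_ _≡_ (lookup π))
  injective? = map′ (λ inj {x} {y} → inj x y) (λ inj x y → inj {x} {y})
    (all? λ x → all? λ y → (lookup π x ≟ᶠ lookup π y) →-dec (x ≟ᶠ y))

  surjective? : Dec (Surjective _≡_ _≡_ (lookup π))
  surjective? = map′
    (λ surj y → proj₁ (surj y) , λ z≡x → trans (cong (lookup π) z≡x) (proj₂ (surj y)))
    (λ surj y → proj₁ (surj y) , proj₂ (surj y) refl)
    (all? λ y → any? λ x → lookup π x ≟ᶠ y)

words : ∀ m → List A → List (Vec A m)
words zero    xs = Vec.[] ∷ []
words (suc m) xs = cartesianProductWith Vec._∷_ xs (words m xs)

-- `words n (allFin n)` lists every word of length n over Fin n exactly once,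
-- so `permutations n` lists every n-permutation exactly once.
permutations : ∀ n → List (Vec (Fin n) n)
permutations n = filter isPermutation? (words n (allFin n))

∈-words : ∀ {m} (w : Vec (Fin n) m) → w ∈ words m (allFin n)
∈-words Vec.[]      = here refl
∈-words (x Vec.∷ w) = ∈-cartesianProductWith⁺ Vec._∷_ (∈-allFin x) (∈-words w)

∈-permutations : (π : Vec (Fin n) n) → IsPermutation π → π ∈ permutations n
∈-permutations π perm = ∈-filter⁺ isPermutation? (∈-words π) perm

identity-isPermutation : ∀ n → IsPermutation (Vec.allFin n)
identity-isPermutation n =
    (λ {x} {y} eq → trans (sym (lookup-allFin x)) (trans eq (lookup-allFin y)))
  , (λ y → y , λ { refl → lookup-allFin y })

∈⇒nonZero : ∀ {x : A} {xs} → x ∈ xs → ℕ.NonZero (length xs)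
∈⇒nonZero (here _)  = _
∈⇒nonZero (there _) = _

permutations-nonZero : ∀ n → ℕ.NonZero (length (permutations n))
permutations-nonZero n =
  ∈⇒nonZero (∈-permutations (Vec.allFin n) (identity-isPermutation n))

mean : (xs : List A) .{{_ : ℕ.NonZero (length xs)}} → (A → ℚ) → ℚ
mean xs X = foldr _+_ 0ℚ (map X xs) * (+ 1 / length xs)

-- Expectation of X(π) for π uniformly distributed over all n-permutations.
𝔼 : ∀ n → (Vec (Fin n) n → ℚ) → ℚ
𝔼 n X = mean (permutations n) {{permutations-nonZero n}} X

Adjacent : Fin n → Fin n → Set
Adjacent i j = suc (toℕ i) ≡ toℕ j ⊎ suc (toℕ j) ≡ toℕ i

adjacent? : (i j : Fin n) → Dec (Adjacent i j)
adjacent? i j = (suc (toℕ i) ≟ toℕ j) ⊎-dec (suc (toℕ j) ≟ toℕ i)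

-- The first and last positions have a single adjacent position, so only the
-- existing neighbour is compared there.
IsValley IsPeak IsLocalExtremum : Vec (Fin n) n → Pred (Fin n) 0ℓ
IsValley π i = ∀ j → Adjacent i j → lookup π i < lookup π j
IsPeak   π i = ∀ j → Adjacent i j → lookup π j < lookup π i
IsLocalExtremum π i = IsValley π i ⊎ IsPeak π i

isLocalExtremum? : (π : Vec (Fin n) n) → Decidable (IsLocalExtremum π)
isLocalExtremum? π i =
  (all? λ j → adjacent? i j →-dec (lookup π i <? lookup π j)) ⊎-dec
  (all? λ j → adjacent? i j →-dec (lookup π j <? lookup π i))

consToFirst : A → List (List A) → List (List A)
consToFirst x []       = (x ∷ []) ∷ []
consToFirst x (b ∷ bs) = (x ∷ b) ∷ bs

-- Cuts a list into consecutive blocks, ending a block after each element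
-- satisfying the predicate (and at the end of the list).
splitAfter : {P : Pred A 0ℓ} → Decidable P → List A → List (List A)
splitAfter P? []       = []
splitAfter P? (x ∷ xs) =
  if does (P? x) then (x ∷ []) ∷ splitAfter P? xs
                 else consToFirst x (splitAfter P? xs)

-- For a list whose first element satisfies the predicate: that element does
-- not end a block, so the first block extends up to and including the second
-- element satisfying the predicate, and each later block ends at the next one.
splitRuns : {P : Pred A 0ℓ} → Decidable P → List A → List (List A)
splitRuns P? []       = []
splitRuns P? (x ∷ xs) = consToFirst x (splitAfter P? xs)

-- Each run is given by the list of its positions.  The first position is
-- always a local extremum, as `splitRuns` presupposes.
runs : Vec (Fin n) n → List (List (Fin n))
runs {n} π = splitRuns (isLocalExtremum? π) (allFin n)

R : Vec (Fin n) n → ℕ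
R π = length (runs π)

{-# OPTIONS --safe #-}

-- Removing its least entry splits a permutation into two words.  Placed between
-- sentinels −∞, a permutation has as many local extrema as these words have
-- together, plus one if they are both empty or both nonempty.  Hence, for y = 1.784
-- and ext = 1 + number of extrema (0 for the empty word), the sums
-- vₙ = Σ y ^ ext(π) / n! satisfy v₀ = 1, v₁ = y² and
-- (n + 1) vₙ₊₁ = Σ vₖ vₙ₋ₖ for n ≥ 1, and R ≤ 1 + ext.  If wₙ rⁿ⁺¹ with r = 1.515
-- satisfies these relations with ≥ in place of =, then vₙ ≤ wₙ rⁿ⁺¹.  A sequence w
-- that is 1 from index N on does so for n ≥ 2N - 1 as soon as its first N terms sum to
-- at most N; N = 6 is possible because r exceeds the true growth rate
-- √(y² - 1) / arccos(1 / y) ≈ 1.514 of vₙ.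

module Submission where

open import Defs
open import Algebra.Bundles using (CommutativeRing)
open import Data.Bool.Base using (Bool; true; false; if_then_else_; _xor_)
open import Data.Fin.Base as Fin using (Fin; zero; suc; toℕ; punchIn; punchOut; inject₁)
open import Data.Fin.Properties as Fin
  using (punchIn-injective; punchInᵢ≢i; punchIn-punchOut; _<?_)
open import Data.Integer.Base as ℤ using (+_)
import Data.Integer.Properties as ℤ
import Data.Integer.Solver as ℤ
open import Data.List.Base
  using (List; []; _∷_; [_]; _++_; length; map; foldr; filter; allFin; tabulate; concatMap;
         cartesianProductWith)
open import Data.List.Membership.Propositional using (_∈_; find; lose)
open import Data.List.Membership.Propositional.Properties
open import Data.List.Membership.Propositional.Properties.WithK using (unique∧set⇒bag)
open import Data.List.Properties
  using (length-++; length-++-sucʳ; length-map; length-tabulate; length-filter; map-++; map-∘; map-cong;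
         ++-assoc; ∷-injective)
open import Data.List.Relation.Binary.BagAndSetEquality using (∼bag⇒↭)
open import Data.List.Relation.Binary.Permutation.Propositional
  using (_↭_; ↭-refl; ↭-sym; ↭-trans; ↭-reflexive; prep; ↭⇒↭ₛ)
open import Data.List.Relation.Binary.Permutation.Propositional.Properties as ↭
  using (shift; drop-mid; ↭-length; ∈-resp-↭; ↭-empty-inv)
open import Data.List.Relation.Binary.Permutation.Setoid.Properties using (foldr-commMonoid)
open import Data.List.Relation.Binary.Sublist.Propositional using (_⊆_; []; _∷_; _∷ʳ_)
open import Data.List.Relation.Binary.Sublist.Propositional.Properties using (All-resp-⊆)
open import Data.List.Relation.Unary.All as All using (All; []; _∷_)
import Data.List.Relation.Unary.All.Properties as All
open import Data.List.Relation.Unary.AllPairs using (AllPairs; []; _∷_)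
import Data.List.Relation.Unary.AllPairs.Properties as AllPairs
open import Data.List.Relation.Unary.Any as Any using (here; there)
open import Data.List.Relation.Unary.Linked using (Linked; [-]; _∷_)
open import Data.List.Relation.Unary.Unique.Propositional using (Unique)
import Data.List.Relation.Unary.Unique.Propositional.Properties as Unique
open import Data.Nat.Base as ℕ using (ℕ; zero; suc; _!; z≤n; s≤s)
open import Data.Nat.ListAction using (sum)
open import Data.Nat.ListAction.Properties using (sum-++)
import Data.Nat.Properties as ℕ
import Data.Nat.Solver as ℕ
open import Data.Product.Base using (∃; ∃₂; _×_; _,_; proj₁; proj₂; map₁; map₂)
open import Data.Rational.Base
  using (ℚ; 0ℚ; 1ℚ; _+_; _*_; _/_; _≤_; toℚᵘ; nonNegative)
open import Data.Rational.Properties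
  using (≤-refl; ≤-reflexive; ≤-trans; _≤?_; nonNegative⁻¹; normalize-nonNeg; toℚᵘ-injective; toℚᵘ-fromℚᵘ;
         toℚᵘ-homo-+; toℚᵘ-homo-*; +-identityˡ; +-identityʳ; +-assoc; *-identityˡ; *-identityʳ; *-zeroˡ; *-zeroʳ;
         *-distribˡ-+; *-distribʳ-+; +-mono-≤; +-monoʳ-≤; *-monoˡ-≤-nonNeg; *-monoʳ-≤-nonNeg;
         +-0-isCommutativeMonoid; +-*-commutativeRing; module ≤-Reasoning)
open import Data.Rational.Solver using (module +-*-Solver)
import Data.Rational.Unnormalised.Base as ℚᵘ
import Data.Rational.Unnormalised.Properties as ℚᵘ
open import Data.Sum.Base using (inj₁; inj₂)
open import Data.Vec.Base as Vec using (Vec; lookup)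
open import Data.Vec.Properties using (tabulate∘lookup; tabulate-cong; lookup-map)
  renaming (∷-injective to Vec-∷-injective)
open import Function.Base using (_∘_; id)
open import Function.Bundles using (mk⇔)
open import Level using (0ℓ)
open import Relation.Binary.PropositionalEquality
  using (_≡_; refl; sym; trans; cong; cong₂; subst; setoid; module ≡-Reasoning)
open import Relation.Nullary using (yes; no; does; contradiction)
open import Relation.Nullary.Decidable using (dec-true; dec-false; from-yes)
open import Relation.Unary using (Pred; Decidable)

open import Algebra.Properties.Semiring.Exp (CommutativeRing.semiring +-*-commutativeRing) using (^-homo-*)

private
  variable
    A X Y Z : Set
    n : ℕ
    x a : Fin n
    us vs xs ys : List A

-- Splits of a list, and arrangements built around its first entry.

-- Each entry of `xs` is deleted from `ys` in turn; by uniqueness the later entries survive the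
-- deletion. The leftover `zs` makes comparisons of lengths and of nonnegative sums immediate.
unique-⊆⇒↭ : Unique xs → (∀ {x} → x ∈ xs → x ∈ ys) → ∃ λ zs → ys ↭ xs ++ zs
unique-⊆⇒↭ {ys = ys} [] _ = ys , ↭-refl
unique-⊆⇒↭ {xs = x ∷ xs} (x∉xs ∷ xs!) xs⊆ys
  with as , bs , refl ← ∈-∃++ (xs⊆ys (here refl))
  with zs , as++bs↭ ← unique-⊆⇒↭ {ys = as ++ bs} xs! (λ y∈xs →
         Any.tail (λ { refl → All.lookup x∉xs y∈xs refl }) (∈-resp-↭ (shift x as bs) (xs⊆ys (there y∈xs))))
  = zs , ↭-trans (shift x as bs) (prep x as++bs↭)

splits : List A → List (List A × List A)
splits []       = [ [] , [] ]
splits (x ∷ xs) = map (map₁ (x ∷_)) (splits xs) ++ map (map₂ (x ∷_)) (splits xs)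

-- Both halves keep the order of `xs`, so sortedness and a lower bound on the entries pass to them.
splits-sublists : ∀ xs → (us , vs) ∈ splits {A} xs →
                  us ⊆ xs × vs ⊆ xs × length us ℕ.+ length vs ≡ length xs
splits-sublists []       (here refl) = [] , [] , refl
splits-sublists (x ∷ xs) uv∈ with ∈-++⁻ (map (map₁ (x ∷_)) (splits xs)) uv∈
... | inj₁ uv∈ˡ with _ , uv∈ , refl ← ∈-map⁻ _ uv∈ˡ with us⊆ , vs⊆ , eq ← splits-sublists xs uv∈
    = refl ∷ us⊆ , x ∷ʳ vs⊆ , cong suc eq
... | inj₂ uv∈ʳ with _ , uv∈ , refl ← ∈-map⁻ _ uv∈ʳ with us⊆ , vs⊆ , eq ← splits-sublists xs uv∈
    = x ∷ʳ us⊆ , refl ∷ vs⊆ , trans (ℕ.+-suc _ _) (cong suc eq)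

-- The head `x` lies in `us` or in `vs`. Deleting it there leaves a rearrangement of the tail, and
-- it returns to the front of the same half. Agreement is up to permutation because `splits` keeps
-- the order of `xs`.
splits-complete : ∀ (xs us vs : List A) → us ++ vs ↭ xs →
                  ∃₂ λ us′ vs′ → (us′ , vs′) ∈ splits xs × us ↭ us′ × vs ↭ vs′
splits-complete [] [] vs p with refl ← ↭-empty-inv p = [] , [] , here refl , ↭-refl , ↭-refl
splits-complete [] (u ∷ us) vs p with () ← ↭-empty-inv p
splits-complete (x ∷ xs) us vs p with ∈-++⁻ us (∈-resp-↭ (↭-sym p) (here refl))
... | inj₁ x∈us
  with us₁ , us₂ , refl ← ∈-∃++ x∈us
  with us′ , vs′ , uv∈ , us↭ , vs↭ ← splits-complete xs (us₁ ++ us₂) vs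
         (↭-trans (↭-reflexive (++-assoc us₁ us₂ vs))
           (drop-mid us₁ [] (↭-trans (↭-reflexive (sym (++-assoc us₁ (x ∷ us₂) vs))) p)))
  = x ∷ us′ , vs′ , ∈-++⁺ˡ (∈-map⁺ (map₁ (x ∷_)) uv∈)
  , ↭-trans (shift x us₁ us₂) (prep x us↭) , vs↭
... | inj₂ x∈vs
  with vs₁ , vs₂ , refl ← ∈-∃++ x∈vs
  with us′ , vs′ , uv∈ , us↭ , vs↭ ← splits-complete xs us (vs₁ ++ vs₂)
         (↭-trans (↭-reflexive (sym (++-assoc us vs₁ vs₂)))
           (drop-mid (us ++ vs₁) [] (↭-trans (↭-reflexive (++-assoc us vs₁ (x ∷ vs₂))) p)))
  = us′ , x ∷ vs′ , ∈-++⁺ʳ _ (∈-map⁺ (map₂ (x ∷_)) uv∈)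
  , us↭ , ↭-trans (shift x vs₁ vs₂) (prep x vs↭)

-- Every arrangement of x ∷ xs is u ++ x ∷ v with u and v arrangements of
-- complementary sublists of xs.  The first argument is a bound on the length
-- of the list, on which the recursion is structural.
arrangements : ℕ → List A → List (List A)
arrangements zero    _        = [ [] ]
arrangements (suc n) []       = [ [] ]
arrangements (suc n) (x ∷ xs) = concatMap
  (λ (us , vs) → cartesianProductWith (λ u v → u ++ x ∷ v) (arrangements n us) (arrangements n vs))
  (splits xs)

-- Cutting `w` at `x` leaves a rearrangement of `xs`, to which `splits-complete` applies.
-- Completeness is what bounds a nonnegative sum over distinct words by the sum over this list.
arrangements-complete : ∀ n {xs w : List A} → length xs ℕ.≤ n → w ↭ xs → w ∈ arrangements n xs
arrangements-complete zero    {[]} _ p = here (↭-empty-inv p)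
arrangements-complete (suc n) {[]} _ p = here (↭-empty-inv p)
arrangements-complete (suc n) {x ∷ xs} (s≤s len) p
  with u , v , refl ← ∈-∃++ (∈-resp-↭ (↭-sym p) (here refl))
  with us , vs , uv∈ , u↭ , v↭ ← splits-complete xs u v (drop-mid u [] p)
  with _ , _ , eq ← splits-sublists xs uv∈
  = ∈-concatMap⁺ _ (lose uv∈ (∈-cartesianProductWith⁺ (λ u v → u ++ x ∷ v)
      (arrangements-complete n (ℕ.≤-trans (ℕ.m+n≤o⇒m≤o _ (ℕ.≤-reflexive eq)) len) u↭)
      (arrangements-complete n (ℕ.≤-trans (ℕ.m+n≤o⇒n≤o _ (ℕ.≤-reflexive eq)) len) v↭)))

arrangements-All : ∀ {P : A → Set} n {xs w} → All P xs → w ∈ arrangements n xs → All P w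
arrangements-All zero    _  (here refl) = []
arrangements-All (suc n) [] (here refl) = []
arrangements-All (suc n) {x ∷ xs} (px ∷ pxs) w∈
  with (us , vs) , uv∈ , w∈ ← find (∈-concatMap⁻ _ {xs = splits xs} w∈)
  with us⊆ , vs⊆ , _ ← splits-sublists xs uv∈
  with u , v , u∈ , v∈ , refl ← ∈-cartesianProductWith⁻ _ (arrangements n us) (arrangements n vs) w∈
  = All.++⁺ (arrangements-All n (All-resp-⊆ us⊆ pxs) u∈)
            (px ∷ arrangements-All n (All-resp-⊆ vs⊆ pxs) v∈)

arrangements-length : ∀ n {xs w : List A} → length xs ℕ.≤ n → w ∈ arrangements n xs → length w ≡ length xs
arrangements-length zero    {[]} _ (here refl) = refl
arrangements-length (suc n) {[]} _ (here refl) = refl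
arrangements-length (suc n) {x ∷ xs} (s≤s len) w∈
  with (us , vs) , uv∈ , w∈ ← find (∈-concatMap⁻ _ {xs = splits xs} w∈)
  with _ , _ , eq ← splits-sublists xs uv∈
  with u , v , u∈ , v∈ , refl ← ∈-cartesianProductWith⁻ _ (arrangements n us) (arrangements n vs) w∈
  = begin
  length (u ++ x ∷ v)             ≡⟨ length-++-sucʳ u x v ⟩
  suc (length (u ++ v))           ≡⟨ cong suc (length-++ u) ⟩
  suc (length u ℕ.+ length v)     ≡⟨ cong suc (cong₂ ℕ._+_
    (arrangements-length n (ℕ.≤-trans (ℕ.m+n≤o⇒m≤o _ (ℕ.≤-reflexive eq)) len) u∈)
    (arrangements-length n (ℕ.≤-trans (ℕ.m+n≤o⇒n≤o _ (ℕ.≤-reflexive eq)) len) v∈)) ⟩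
  suc (length us ℕ.+ length vs)   ≡⟨ cong suc eq ⟩
  suc (length xs)                 ∎
  where open ≡-Reasoning

-- Direction changes of a word and their additivity at the minimum.

rises : Fin n → Fin n → Bool
rises a b = does (a <? b)

bend : Bool → Bool → ℕ
bend d e = if d xor e then 1 else 0

-- Counts the changes of direction in the word a ∷ w followed by −∞, where d
-- tells whether a is entered by a rise.
turns : Bool → Fin n → List (Fin n) → ℕ
turns d a []      = bend d false
turns d a (b ∷ w) = bend d (rises a b) ℕ.+ turns (rises a b) b w

-- One more than the number of local extrema of the word between two sentinels
-- −∞; the convention for [] makes ext additive over splitting at the minimum.
ext : List (Fin n) → ℕ
ext []      = 0
ext (a ∷ w) = suc (turns true a w)

<⇒rises : {a b : Fin n} → a Fin.< b → rises a b ≡ true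
<⇒rises {a = a} {b} = dec-true (a <? b)

>⇒falls : {a b : Fin n} → b Fin.< a → rises a b ≡ false
>⇒falls {a = a} {b} b<a = dec-false (a <? b) (ℕ.<-asym b<a)

-- Seen from `us`, the minimum `x` acts like the final -∞. If `vs` is nonempty, `x` is a valley and
-- its bend is the `suc` in `ext vs`; if `vs` is empty, the fall continues through `x` to -∞ without
-- a bend.
turns-split : ∀ d {us vs} → x Fin.< a → All (x Fin.<_) us → All (x Fin.<_) vs →
              turns d a (us ++ x ∷ vs) ≡ turns d a us ℕ.+ ext vs
turns-split d {[]} {[]} x<a _ _ rewrite >⇒falls x<a = refl
turns-split d {[]} {v ∷ vs} x<a _ (x<v ∷ _) rewrite >⇒falls x<a | <⇒rises x<v = refl
turns-split {a = a} d {u ∷ us} {vs} x<a (x<u ∷ x<us) x<vs = trans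
  (cong (bend d (rises a u) ℕ.+_) (turns-split (rises a u) x<u x<us x<vs))
  (sym (ℕ.+-assoc (bend d (rises a u)) _ _))

-- For empty `us` the rise from -∞ passes through `x` without a bend. The length hypothesis excludes
-- the word consisting of `x` alone, whose `ext` is 2 and not 0.
ext-split : ∀ {us vs} → All (x Fin.<_) us → All (x Fin.<_) vs → 1 ℕ.≤ length us ℕ.+ length vs →
            ext (us ++ x ∷ vs) ≡ ext us ℕ.+ ext vs
ext-split {us = []} {v ∷ vs} _ (x<v ∷ _) _ rewrite <⇒rises x<v = refl
ext-split {us = u ∷ us} (x<u ∷ x<us) x<vs _ = cong suc (turns-split true x<u x<us x<vs)

-- Alternating runs bounded by direction changes.

length-consToFirst : ∀ (x : X) xss {k} → length xss ℕ.≤ suc k → length (consToFirst x xss) ℕ.≤ suc k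
length-consToFirst x []       _ = s≤s z≤n
length-consToFirst x (_ ∷ _) le = le

module _ {P : Pred X 0ℓ} (P? : Decidable P) where

  -- Every block except possibly the last ends at an entry satisfying `P`.
  length-splitAfter : ∀ xs → length (splitAfter P? xs) ℕ.≤ suc (length (filter P? xs))
  length-splitAfter [] = z≤n
  length-splitAfter (x ∷ xs) with P? x
  ... | yes _ = s≤s (length-splitAfter xs)
  ... | no  _ = length-consToFirst x (splitAfter P? xs) (length-splitAfter xs)

  length-splitRuns : ∀ x xs → length (splitRuns P? (x ∷ xs)) ℕ.≤ suc (length (filter P? xs))
  length-splitRuns x xs = length-consToFirst x (splitAfter P? xs) (length-splitAfter xs)

Succ : Fin n → Fin n → Set
Succ i j = suc (toℕ i) ≡ toℕ j

tabulate-linked : ∀ {R : X → X → Set} {m} (f : Fin (suc m) → X) →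
                  (∀ i → R (f (inject₁ i)) (f (suc i))) → Linked R (tabulate f)
tabulate-linked {m = zero}  f Rf = [-]
tabulate-linked {m = suc m} f Rf = Rf zero ∷ tabulate-linked (f ∘ suc) (Rf ∘ suc)

module _ {n} (π : Vec (Fin n) n) {P : Pred (Fin n) 0ℓ} (P? : Decidable P)
         (P⇒extremum : ∀ {j} → P j → IsLocalExtremum π j) where

  extremum-bend : ∀ {i j k} → Succ i j → Succ j k → P j →
                  bend (rises (lookup π i) (lookup π j)) (rises (lookup π j) (lookup π k)) ≡ 1
  extremum-bend {i} {j} {k} ij jk Pj with P⇒extremum Pj
  ... | inj₁ valley rewrite >⇒falls (valley i (inj₂ ij)) | <⇒rises (valley k (inj₁ jk)) = refl
  ... | inj₂ peak   rewrite <⇒rises (peak i (inj₂ ij)) | >⇒falls (peak k (inj₁ jk)) = refl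

  firstBend : Bool → Fin n → List (Fin n) → ℕ
  firstBend d i []      = 0
  firstBend d i (j ∷ _) = bend d (rises (lookup π i) (lookup π j))

  -- An extremum in `js` that has a successor there is a bend; the last entry of `js` is paid for by
  -- `suc`. With `firstBend` on the left the induction closes: the bend that pays for `j` is the
  -- first bend of the recursive call.
  extrema≤turns : ∀ d i js → Linked Succ (i ∷ js) →
    firstBend d i js ℕ.+ length (filter P? js) ℕ.≤ suc (turns d (lookup π i) (map (lookup π) js))
  extrema≤turns d i [] _ = z≤n
  extrema≤turns d i (j ∷ []) _ = begin
    firstBend d i (j ∷ []) ℕ.+ length (filter P? (j ∷ []))
      ≤⟨ ℕ.+-monoʳ-≤ _ (length-filter P? (j ∷ [])) ⟩
    firstBend d i (j ∷ []) ℕ.+ 1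
      ≡⟨ ℕ.+-comm _ 1 ⟩
    suc (firstBend d i (j ∷ []))
      ≤⟨ s≤s (ℕ.m≤m+n _ _) ⟩
    suc (turns d (lookup π i) (lookup π j ∷ [])) ∎
    where open ℕ.≤-Reasoning
  extrema≤turns d i (j ∷ k ∷ ks) (ij ∷ jk ∷ linked) = begin
    b ℕ.+ length (filter P? (j ∷ k ∷ ks))
      ≤⟨ ℕ.+-monoʳ-≤ b first ⟩
    b ℕ.+ (bend e (rises (lookup π j) (lookup π k)) ℕ.+ length (filter P? (k ∷ ks)))
      ≤⟨ ℕ.+-monoʳ-≤ b (extrema≤turns e j (k ∷ ks) (jk ∷ linked)) ⟩
    b ℕ.+ suc (turns e (lookup π j) (map (lookup π) (k ∷ ks)))
      ≡⟨ ℕ.+-suc b _ ⟩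
    suc (turns d (lookup π i) (map (lookup π) (j ∷ k ∷ ks))) ∎
    where
    open ℕ.≤-Reasoning
    e = rises (lookup π i) (lookup π j)
    b = bend d e
    first : length (filter P? (j ∷ k ∷ ks)) ℕ.≤
            bend e (rises (lookup π j) (lookup π k)) ℕ.+ length (filter P? (k ∷ ks))
    first with P? j
    ... | yes Pj rewrite extremum-bend ij jk Pj = ℕ.≤-refl
    ... | no  _  = ℕ.m≤n+m _ _

word : Vec (Fin n) n → List (Fin n)
word {n} π = map (lookup π) (allFin n)

R≤1+ext : ∀ (π : Vec (Fin n) n) → R π ℕ.≤ suc (ext (word π))
R≤1+ext {zero}  Vec.[] = z≤n
R≤1+ext {suc m} π = begin
  R π                                                       ≤⟨ length-splitRuns E? zero (tabulate suc) ⟩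
  suc (length (filter E? (tabulate suc)))                   ≤⟨ s≤s (ℕ.m≤n+m _ _) ⟩
  suc (firstBend π E? id true zero (tabulate suc) ℕ.+ length (filter E? (tabulate suc)))
    ≤⟨ s≤s (extrema≤turns π E? id true zero (tabulate suc)
         (tabulate-linked id (λ i → cong suc (Fin.toℕ-inject₁ i)))) ⟩
  suc (suc (turns true (lookup π zero) (map (lookup π) (tabulate suc)))) ∎
  where
  open ℕ.≤-Reasoning
  E? = isLocalExtremum? π

-- Permutations as distinct words, and a lower bound for their number.

map-≡⇒ : ∀ {f g : X → Y} xs → map f xs ≡ map g xs → ∀ {x} → x ∈ xs → f x ≡ g x
map-≡⇒ (x ∷ xs) eq (here refl) = proj₁ (∷-injective eq)
map-≡⇒ (x ∷ xs) eq (there x∈)  = map-≡⇒ xs (proj₂ (∷-injective eq)) x∈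

lookup-injective : ∀ {v w : Vec X n} → (∀ i → lookup v i ≡ lookup w i) → v ≡ w
lookup-injective {v = v} {w} eq =
  trans (sym (tabulate∘lookup v)) (trans (tabulate-cong eq) (tabulate∘lookup w))

word-injective : {π ρ : Vec (Fin n) n} → word π ≡ word ρ → π ≡ ρ
word-injective {n} eq = lookup-injective λ i → map-≡⇒ (allFin n) eq (∈-allFin i)

unique-full⇒↭ : ∀ {w : List (Fin n)} → Unique w → (∀ i → i ∈ w) → w ↭ allFin n
unique-full⇒↭ {n} w! full =
  ∼bag⇒↭ (unique∧set⇒bag w! (Unique.allFin⁺ n) (mk⇔ (λ _ → ∈-allFin _) (λ _ → full _)))

word-↭ : (π : Vec (Fin n) n) → IsPermutation π → word π ↭ allFin n
word-↭ {n} π (inj , surj) = unique-full⇒↭ (Unique.map⁺ inj (Unique.allFin⁺ n)) λ y →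
  let i , eq = surj y in subst (_∈ word π) (eq refl) (∈-map⁺ (lookup π) (∈-allFin i))

words-unique : ∀ m {xs : List X} → Unique xs → Unique (words m xs)
words-unique zero    _   = [] ∷ []
words-unique (suc m) xs! = Unique.cartesianProductWith⁺ Vec._∷_ Vec-∷-injective xs! (words-unique m xs!)

permutations-unique : ∀ n → Unique (permutations n)
permutations-unique n = Unique.filter⁺ isPermutation? (words-unique n (Unique.allFin⁺ n))

insertFirst : Fin (suc n) → Vec (Fin n) n → Vec (Fin (suc n)) (suc n)
insertFirst i σ = i Vec.∷ Vec.map (punchIn i) σ

insertFirst-injective : ∀ {i j : Fin (suc n)} {σ τ} → insertFirst i σ ≡ insertFirst j τ → i ≡ j × σ ≡ τ
insertFirst-injective {i = i} {σ = σ} {τ} eq with refl , eq′ ← Vec-∷-injective eq =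
  refl , lookup-injective λ k → punchIn-injective i _ _
    (trans (sym (lookup-map k (punchIn i) σ)) (trans (cong (λ v → lookup v k) eq′) (lookup-map k (punchIn i) τ)))

insertFirst-isPermutation : ∀ i (σ : Vec (Fin n) n) → IsPermutation σ → IsPermutation (insertFirst i σ)
insertFirst-isPermutation i σ (inj , surj) = inj′ , surj′
  where
  inj′ : ∀ {j k} → lookup (insertFirst i σ) j ≡ lookup (insertFirst i σ) k → j ≡ k
  inj′ {zero}  {zero}  _  = refl
  inj′ {zero}  {suc k} eq = contradiction (sym (trans eq (lookup-map k (punchIn i) σ))) (punchInᵢ≢i i _)
  inj′ {suc j} {zero}  eq = contradiction (trans (sym (lookup-map j (punchIn i) σ)) eq) (punchInᵢ≢i i _)
  inj′ {suc j} {suc k} eq = cong suc (inj (punchIn-injective i _ _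
    (trans (sym (lookup-map j (punchIn i) σ)) (trans eq (lookup-map k (punchIn i) σ)))))

  surj′ : ∀ y → ∃ λ j → ∀ {k} → k ≡ j → lookup (insertFirst i σ) k ≡ y
  surj′ y with i Fin.≟ y
  ... | yes refl = zero , λ { refl → refl }
  ... | no  i≢y with j , eq ← surj (punchOut i≢y) = suc j , λ { refl →
    trans (lookup-map j (punchIn i) σ) (trans (cong (punchIn i) (eq refl)) (punchIn-punchOut i≢y)) }

-- Permutations enumerated by their Lehmer codes: a first entry, then the relative order of the
-- rest. Its `n !` distinct members bound the denominator of the mean from below.
lehmer : ∀ n → List (Vec (Fin n) n)
lehmer zero    = [ Vec.[] ]
lehmer (suc n) = cartesianProductWith insertFirst (allFin (suc n)) (lehmer n)

lehmer-unique : ∀ n → Unique (lehmer n)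
lehmer-unique zero    = [] ∷ []
lehmer-unique (suc n) =
  Unique.cartesianProductWith⁺ insertFirst insertFirst-injective (Unique.allFin⁺ (suc n)) (lehmer-unique n)

lehmer-isPermutation : ∀ n {σ} → σ ∈ lehmer n → IsPermutation σ
lehmer-isPermutation zero    (here refl) = (λ { {()} }) , λ ()
lehmer-isPermutation (suc n) σ∈
  with i , σ , _ , σ∈ , refl ← ∈-cartesianProductWith⁻ insertFirst (allFin (suc n)) (lehmer n) σ∈
  = insertFirst-isPermutation i σ (lehmer-isPermutation n σ∈)

length-cartesianProductWith : ∀ (f : X → Y → Z) xs ys →
  length (cartesianProductWith f xs ys) ≡ length xs ℕ.* length ys
length-cartesianProductWith f []       ys = refl
length-cartesianProductWith f (x ∷ xs) ys = trans (length-++ (map (f x) ys))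
  (cong₂ ℕ._+_ (length-map (f x) ys) (length-cartesianProductWith f xs ys))

length-lehmer : ∀ n → length (lehmer n) ≡ n !
length-lehmer zero    = refl
length-lehmer (suc n) = trans (length-cartesianProductWith insertFirst (allFin (suc n)) (lehmer n))
  (cong₂ ℕ._*_ (length-tabulate {n = suc n} id) (length-lehmer n))

unique-⊆⇒length≤ : ∀ {xs ys : List X} → Unique xs → (∀ {x} → x ∈ xs → x ∈ ys) → length xs ℕ.≤ length ys
unique-⊆⇒length≤ {xs = xs} {ys} xs! xs⊆ys with zs , p ← unique-⊆⇒↭ xs! xs⊆ys = begin
  length xs                ≤⟨ ℕ.m≤m+n _ _ ⟩
  length xs ℕ.+ length zs  ≡⟨ length-++ xs ⟨
  length (xs ++ zs)        ≡⟨ ↭-length p ⟨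
  length ys                ∎
  where open ℕ.≤-Reasoning

n!≤length-permutations : ∀ n → n ! ℕ.≤ length (permutations n)
n!≤length-permutations n = subst (ℕ._≤ length (permutations n)) (length-lehmer n)
  (unique-⊆⇒length≤ (lehmer-unique n) λ σ∈ → ∈-permutations _ (lehmer-isPermutation n σ∈))

-- Sums over the antidiagonal k + l = n, and sums over the splits of a list.

diagonal : (ℕ → ℕ → ℕ) → ℕ → ℕ
diagonal h zero    = h 0 0
diagonal h (suc n) = h 0 (suc n) ℕ.+ diagonal (h ∘ suc) n

diagonal-cong : ∀ {g h : ℕ → ℕ → ℕ} n → (∀ k l → k ℕ.+ l ≡ n → g k l ≡ h k l) → diagonal g n ≡ diagonal h n
diagonal-cong zero    g≡h = g≡h 0 0 refl
diagonal-cong (suc n) g≡h =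
  cong₂ ℕ._+_ (g≡h 0 (suc n) refl) (diagonal-cong n λ k l eq → g≡h (suc k) l (cong suc eq))

diagonal-+ : ∀ (g h : ℕ → ℕ → ℕ) n → diagonal (λ k l → g k l ℕ.+ h k l) n ≡ diagonal g n ℕ.+ diagonal h n
diagonal-+ g h zero    = refl
diagonal-+ g h (suc n) rewrite diagonal-+ (g ∘ suc) (h ∘ suc) n =
  solve 4 (λ a b c d → (a :+ b) :+ (c :+ d) := (a :+ c) :+ (b :+ d)) refl (g 0 (suc n)) (h 0 (suc n)) _ _
  where open ℕ.+-*-Solver

diagonal-* : ∀ c (h : ℕ → ℕ → ℕ) n → diagonal (λ k l → c ℕ.* h k l) n ≡ c ℕ.* diagonal h n
diagonal-* c h zero    = refl
diagonal-* c h (suc n) rewrite diagonal-* c (h ∘ suc) n = sym (ℕ.*-distribˡ-+ c _ _)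

diagonal-last : ∀ (h : ℕ → ℕ → ℕ) n → diagonal h (suc n) ≡ diagonal (λ k l → h k (suc l)) n ℕ.+ h (suc n) 0
diagonal-last h zero    = refl
diagonal-last h (suc n) rewrite diagonal-last (h ∘ suc) n = sym (ℕ.+-assoc (h 0 (suc (suc n))) _ _)

-- On the right, write the factor n + 1 as k + l in each term. The part weighted by k vanishes at k
-- = 0 and the part weighted by l at l = 0; shifting the indices past these zeros gives the two sums
-- on the left.
diagonal-index : ∀ (h : ℕ → ℕ → ℕ) n →
  diagonal (λ k l → suc k ℕ.* h (suc k) l) n ℕ.+ diagonal (λ k l → suc l ℕ.* h k (suc l)) n
  ≡ suc n ℕ.* diagonal h (suc n)
diagonal-index h n = begin
  diagonal (λ k l → suc k ℕ.* h (suc k) l) n ℕ.+ diagonal (λ k l → suc l ℕ.* h k (suc l)) n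
    ≡⟨ cong (diagonal (λ k l → suc k ℕ.* h (suc k) l) n ℕ.+_)
         (sym (trans (diagonal-last (λ k l → l ℕ.* h k l) n) (ℕ.+-identityʳ _))) ⟩
  diagonal (λ k l → k ℕ.* h k l) (suc n) ℕ.+ diagonal (λ k l → l ℕ.* h k l) (suc n)
    ≡⟨ diagonal-+ (λ k l → k ℕ.* h k l) (λ k l → l ℕ.* h k l) (suc n) ⟨
  diagonal (λ k l → k ℕ.* h k l ℕ.+ l ℕ.* h k l) (suc n)
    ≡⟨ diagonal-cong (suc n) (λ k l eq → trans (sym (ℕ.*-distribʳ-+ (h k l) k l)) (cong (ℕ._* h k l) eq)) ⟩
  diagonal (λ k l → suc n ℕ.* h k l) (suc n)
    ≡⟨ diagonal-* (suc n) h (suc n) ⟩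
  suc n ℕ.* diagonal h (suc n) ∎
  where open ≡-Reasoning

splitSum : (ℕ → ℕ → ℕ) → List X → ℕ
splitSum h xs = sum (map (λ (us , vs) → h (length us) (length vs)) (splits xs))

splitSum-cong : ∀ {g h : ℕ → ℕ → ℕ} (xs : List X) → (∀ k l → g k l ≡ h k l) → splitSum g xs ≡ splitSum h xs
splitSum-cong xs g≡h = cong sum (map-cong (λ (us , vs) → g≡h (length us) (length vs)) (splits xs))

splitSum-∷ : ∀ h (x : X) xs → splitSum h (x ∷ xs) ≡ splitSum (h ∘ suc) xs ℕ.+ splitSum (λ k l → h k (suc l)) xs
splitSum-∷ h x xs = begin
  splitSum h (x ∷ xs)
    ≡⟨ cong sum (map-++ _ (map (map₁ (x ∷_)) (splits xs)) _) ⟩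
  sum (map _ (map (map₁ (x ∷_)) (splits xs)) ++ map _ (map (map₂ (x ∷_)) (splits xs)))
    ≡⟨ sum-++ (map _ (map (map₁ (x ∷_)) (splits xs))) _ ⟩
  sum (map _ (map (map₁ (x ∷_)) (splits xs))) ℕ.+ sum (map _ (map (map₂ (x ∷_)) (splits xs)))
    ≡⟨ cong₂ (λ us vs → sum us ℕ.+ sum vs) (map-∘ (splits xs)) (map-∘ (splits xs)) ⟨
  splitSum (h ∘ suc) xs ℕ.+ splitSum (λ k l → h k (suc l)) xs ∎
  where open ≡-Reasoning

-- A list of length n has n! / (k! l!) splits into lengths k and l. Binomial coefficients are
-- avoided: putting the head into one half turns k! into (k + 1) k!, or l! into (l + 1) l!, and
-- `diagonal-index` collects these new factors.
splitSum-factorials : ∀ h (xs : List X) →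
  splitSum (λ k l → k ! ℕ.* l ! ℕ.* h k l) xs ≡ length xs ! ℕ.* diagonal h (length xs)
splitSum-factorials h [] = solve 1 (λ a → con 1 :* a :+ con 0 := con 1 :* a) refl (h 0 0)
  where open ℕ.+-*-Solver
splitSum-factorials h (x ∷ xs) = begin
  splitSum (λ k l → k ! ℕ.* l ! ℕ.* h k l) (x ∷ xs)
    ≡⟨ splitSum-∷ (λ k l → k ! ℕ.* l ! ℕ.* h k l) x xs ⟩
  splitSum (λ k l → suc k ! ℕ.* l ! ℕ.* h (suc k) l) xs ℕ.+ splitSum (λ k l → k ! ℕ.* suc l ! ℕ.* h k (suc l)) xs
    ≡⟨ cong₂ ℕ._+_
         (splitSum-cong {g = λ k l → suc k ! ℕ.* l ! ℕ.* h (suc k) l} xs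
           (λ k l → moveˡ (suc k) (k !) (l !) (h (suc k) l)))
         (splitSum-cong {g = λ k l → k ! ℕ.* suc l ! ℕ.* h k (suc l)} xs
           (λ k l → moveʳ (suc l) (k !) (l !) (h k (suc l)))) ⟩
  splitSum (λ k l → k ! ℕ.* l ! ℕ.* (suc k ℕ.* h (suc k) l)) xs
      ℕ.+ splitSum (λ k l → k ! ℕ.* l ! ℕ.* (suc l ℕ.* h k (suc l))) xs
    ≡⟨ cong₂ ℕ._+_ (splitSum-factorials (λ k l → suc k ℕ.* h (suc k) l) xs)
                   (splitSum-factorials (λ k l → suc l ℕ.* h k (suc l)) xs) ⟩
  ℓ ! ℕ.* diagonal (λ k l → suc k ℕ.* h (suc k) l) ℓ ℕ.+ ℓ ! ℕ.* diagonal (λ k l → suc l ℕ.* h k (suc l)) ℓ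
    ≡⟨ ℕ.*-distribˡ-+ (ℓ !) _ _ ⟨
  ℓ ! ℕ.* (diagonal (λ k l → suc k ℕ.* h (suc k) l) ℓ ℕ.+ diagonal (λ k l → suc l ℕ.* h k (suc l)) ℓ)
    ≡⟨ cong (ℓ ! ℕ.*_) (diagonal-index h ℓ) ⟩
  ℓ ! ℕ.* (suc ℓ ℕ.* diagonal h (suc ℓ))
    ≡⟨ solve 3 (λ f s d → f :* (s :* d) := s :* f :* d) refl (ℓ !) (suc ℓ) (diagonal h (suc ℓ)) ⟩
  suc ℓ ! ℕ.* diagonal h (suc ℓ) ∎
  where
  open ≡-Reasoning
  open ℕ.+-*-Solver
  ℓ = length xs
  moveˡ : ∀ s a b c → s ℕ.* a ℕ.* b ℕ.* c ≡ a ℕ.* b ℕ.* (s ℕ.* c)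
  moveˡ = solve 4 (λ s a b c → s :* a :* b :* c := a :* b :* (s :* c)) refl
  moveʳ : ∀ s a b c → a ℕ.* (s ℕ.* b) ℕ.* c ≡ a ℕ.* b ℕ.* (s ℕ.* c)
  moveʳ = solve 4 (λ s a b c → a :* (s :* b) :* c := a :* b :* (s :* c)) refl

-- The convolution inequality for an eventually constant sequence.

square : (ℕ → ℕ) → ℕ → ℕ → ℕ
square w k l = w k ℕ.* w l

module _ (w : ℕ → ℕ) (M : ℕ) (w≡M : ∀ n → w (6 ℕ.+ n) ≡ M) where

  -- The indices l = 6, ..., 5 + m contribute `M * M` each.
  diagonal-tail : ∀ m → diagonal (λ _ l → M ℕ.* w l) (5 ℕ.+ m)
                      ≡ m ℕ.* (M ℕ.* M) ℕ.+ diagonal (λ _ l → M ℕ.* w l) 5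
  diagonal-tail zero    = refl
  diagonal-tail (suc m) = trans
    (cong₂ (λ a b → M ℕ.* a ℕ.+ b) (w≡M m) (diagonal-tail m))
    (sym (ℕ.+-assoc (M ℕ.* M) (m ℕ.* (M ℕ.* M)) _))

  -- The two sums are the ends k < 6 and l < 6 of a long convolution. Each is M times the sum of the
  -- first six values, so for M > 0 `small` says that these values sum to at most 6 M.
  module _ (small : diagonal (λ k _ → w k ℕ.* M) 5 ℕ.+ diagonal (λ _ l → M ℕ.* w l) 5 ℕ.≤ 12 ℕ.* (M ℕ.* M)) where

    -- For n ≥ 11 every product in the convolution has a factor M, so each
    -- increase of n by one adds M * M to both sides.
    diagonal-large : ∀ m → diagonal (square w) (11 ℕ.+ m) ℕ.≤ M ℕ.* ((12 ℕ.+ m) ℕ.* w (12 ℕ.+ m))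
    diagonal-large m = begin
      diagonal (square w) (11 ℕ.+ m)
        ≡⟨ regroup (w² 0 (11 ℕ.+ m)) (w² 1 (10 ℕ.+ m)) (w² 2 (9 ℕ.+ m))
                   (w² 3 (8 ℕ.+ m)) (w² 4 (7 ℕ.+ m)) (w² 5 (6 ℕ.+ m)) _ ⟩
      diagonal (λ k l → w k ℕ.* w (6 ℕ.+ l ℕ.+ m)) 5 ℕ.+ diagonal (λ k l → w (6 ℕ.+ k) ℕ.* w l) (5 ℕ.+ m)
        ≡⟨ cong₂ ℕ._+_
             (diagonal-cong {g = λ k l → w k ℕ.* w (6 ℕ.+ l ℕ.+ m)} {h = λ k _ → w k ℕ.* M} 5
               λ k l _ → cong (w k ℕ.*_) (w≡M (l ℕ.+ m)))
             (trans (diagonal-cong (5 ℕ.+ m) λ k l _ → cong (ℕ._* w l) (w≡M k)) (diagonal-tail m)) ⟩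
      diagonal (λ k _ → w k ℕ.* M) 5 ℕ.+ (m ℕ.* (M ℕ.* M) ℕ.+ diagonal (λ _ l → M ℕ.* w l) 5)
        ≡⟨ solve 3 (λ a b c → a :+ (b :+ c) := (a :+ c) :+ b) refl (diagonal (λ k _ → w k ℕ.* M) 5) _ _ ⟩
      diagonal (λ k _ → w k ℕ.* M) 5 ℕ.+ diagonal (λ _ l → M ℕ.* w l) 5 ℕ.+ m ℕ.* (M ℕ.* M)
        ≤⟨ ℕ.+-monoˡ-≤ _ small ⟩
      12 ℕ.* (M ℕ.* M) ℕ.+ m ℕ.* (M ℕ.* M)
        ≡⟨ solve 2 (λ b m → con 12 :* (b :* b) :+ m :* (b :* b) := b :* ((con 12 :+ m) :* b)) refl M m ⟩
      M ℕ.* ((12 ℕ.+ m) ℕ.* M)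
        ≡⟨ cong (λ a → M ℕ.* ((12 ℕ.+ m) ℕ.* a)) (w≡M (6 ℕ.+ m)) ⟨
      M ℕ.* ((12 ℕ.+ m) ℕ.* w (12 ℕ.+ m)) ∎
      where
      open ℕ.≤-Reasoning
      open ℕ.+-*-Solver
      w² = square w
      regroup : ∀ a b c d e f t → a ℕ.+ (b ℕ.+ (c ℕ.+ (d ℕ.+ (e ℕ.+ (f ℕ.+ t)))))
                              ≡ a ℕ.+ (b ℕ.+ (c ℕ.+ (d ℕ.+ (e ℕ.+ f)))) ℕ.+ t
      regroup = solve 7 (λ a b c d e f t → a :+ (b :+ (c :+ (d :+ (e :+ (f :+ t)))))
                                        := a :+ (b :+ (c :+ (d :+ (e :+ f)))) :+ t) refl

    diagonal-square : (∀ {n} → n ℕ.< 10 → diagonal (square w) (suc n) ℕ.≤ M ℕ.* (suc (suc n) ℕ.* w (suc (suc n)))) →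
                      ∀ n → diagonal (square w) (suc n) ℕ.≤ M ℕ.* (suc (suc n) ℕ.* w (suc (suc n)))
    diagonal-square below n with n ℕ.<? 10
    ... | yes n<10 = below n<10
    -- The index `suc n` is now at least 11, so k and l cannot both be below 6.
    ... | no  n≮10 with m , refl ← ℕ.m≤n⇒∃[o]m+o≡n (ℕ.≮⇒≥ n≮10) = diagonal-large m

-- Up to n = 5 these are values of 2500 wₙ, rounded upwards at each step, for the
-- solution of (n + 1) wₙ₊₁ = Σ wₖ wₙ₋ₖ (n ≥ 1) with w₀ = 1 / r and w₁ = y² / r².
W : ℕ → ℕ
W 0 = 1651
W 1 = 3467
W 2 = 2290
W 3 = 2611
W 4 = 2451
W 5 = 2516
W (suc (suc (suc (suc (suc (suc _)))))) = 2500

W≤3467 : ∀ n → W n ℕ.≤ 3467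
W≤3467 0 = from-yes (W 0 ℕ.≤? 3467)
W≤3467 1 = from-yes (W 1 ℕ.≤? 3467)
W≤3467 2 = from-yes (W 2 ℕ.≤? 3467)
W≤3467 3 = from-yes (W 3 ℕ.≤? 3467)
W≤3467 4 = from-yes (W 4 ℕ.≤? 3467)
W≤3467 5 = from-yes (W 5 ℕ.≤? 3467)
W≤3467 (suc (suc (suc (suc (suc (suc _)))))) = from-yes (W 6 ℕ.≤? 3467)

W-diagonal : ∀ n → diagonal (square W) (suc n) ℕ.≤ 2500 ℕ.* (suc (suc n) ℕ.* W (suc (suc n)))
W-diagonal = diagonal-square W 2500 (λ _ → refl)
  -- Divided by 5000, this reads 14986 ≤ 15000 for the sum of the first six values.
  (from-yes (diagonal (λ k _ → W k ℕ.* 2500) 5 ℕ.+ diagonal (λ _ l → 2500 ℕ.* W l) 5 ℕ.≤? 12 ℕ.* (2500 ℕ.* 2500)))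
  (from-yes (ℕ.allUpTo? (λ n → diagonal (square W) (suc n) ℕ.≤? 2500 ℕ.* (suc (suc n) ℕ.* W (suc (suc n)))) 10))

-- Monotonicity in the rationals and the embedding of the naturals.

*-mono-≤-nonNeg : ∀ {p q s t} → 0ℚ ≤ p → 0ℚ ≤ s → p ≤ q → s ≤ t → p * s ≤ q * t
*-mono-≤-nonNeg {p} {q} {s} {t} 0≤p 0≤s p≤q s≤t = ≤-trans
  (*-monoˡ-≤-nonNeg p {{nonNegative 0≤p}} s≤t)
  (*-monoʳ-≤-nonNeg t {{nonNegative (≤-trans 0≤s s≤t)}} p≤q)

0≤* : ∀ {p q} → 0ℚ ≤ p → 0ℚ ≤ q → 0ℚ ≤ p * q
0≤* 0≤p 0≤q = *-mono-≤-nonNeg ≤-refl ≤-refl 0≤p 0≤q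

0≤^ : ∀ {p} n → 0ℚ ≤ p → 0ℚ ≤ p ^ n
0≤^ zero    _   = nonNegative⁻¹ 1ℚ
0≤^ (suc n) 0≤p = 0≤* 0≤p (0≤^ n 0≤p)

^-monoʳ-≤ : ∀ {p m n} → 1ℚ ≤ p → m ℕ.≤ n → p ^ m ≤ p ^ n
^-monoʳ-≤ {n = zero}  1≤p z≤n = ≤-refl
^-monoʳ-≤ {n = suc n} 1≤p z≤n = *-mono-≤-nonNeg (nonNegative⁻¹ 1ℚ) (nonNegative⁻¹ 1ℚ) 1≤p (^-monoʳ-≤ {n = n} 1≤p z≤n)
^-monoʳ-≤ {p} 1≤p (s≤s m≤n) =
  *-monoˡ-≤-nonNeg p {{nonNegative (≤-trans (nonNegative⁻¹ 1ℚ) 1≤p)}} (^-monoʳ-≤ 1≤p m≤n)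

ι : ℕ → ℚ
ι n = + n / 1

ι-+ : ∀ m n → ι (m ℕ.+ n) ≡ ι m + ι n
ι-+ m n = toℚᵘ-injective (begin
  toℚᵘ (ι (m ℕ.+ n))
    ≈⟨ toℚᵘ-fromℚᵘ (ℚᵘ.mkℚᵘ (+ (m ℕ.+ n)) 0) ⟩
  ℚᵘ.mkℚᵘ (+ (m ℕ.+ n)) 0
    ≈⟨ ℚᵘ.*≡* (solve 2 (λ a b → (a :+ b) :* con (+ 1)
                              := (a :* con (+ 1) :+ b :* con (+ 1)) :* con (+ 1)) refl (+ m) (+ n)) ⟩
  ℚᵘ.mkℚᵘ (+ m) 0 ℚᵘ.+ ℚᵘ.mkℚᵘ (+ n) 0
    ≈⟨ ℚᵘ.+-cong (toℚᵘ-fromℚᵘ (ℚᵘ.mkℚᵘ (+ m) 0)) (toℚᵘ-fromℚᵘ (ℚᵘ.mkℚᵘ (+ n) 0)) ⟨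
  toℚᵘ (ι m) ℚᵘ.+ toℚᵘ (ι n)
    ≈⟨ toℚᵘ-homo-+ (ι m) (ι n) ⟨
  toℚᵘ (ι m + ι n)                           ∎)
  where
  open import Relation.Binary.Reasoning.Setoid ℚᵘ.≃-setoid
  open ℤ.+-*-Solver

ι-* : ∀ m n → ι (m ℕ.* n) ≡ ι m * ι n
ι-* m n = toℚᵘ-injective (begin
  toℚᵘ (ι (m ℕ.* n))
    ≈⟨ toℚᵘ-fromℚᵘ (ℚᵘ.mkℚᵘ (+ (m ℕ.* n)) 0) ⟩
  ℚᵘ.mkℚᵘ (+ (m ℕ.* n)) 0
    ≈⟨ ℚᵘ.*≡* (cong (ℤ._* + 1) (ℤ.pos-* m n)) ⟩
  ℚᵘ.mkℚᵘ (+ m) 0 ℚᵘ.* ℚᵘ.mkℚᵘ (+ n) 0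
    ≈⟨ ℚᵘ.*-cong (toℚᵘ-fromℚᵘ (ℚᵘ.mkℚᵘ (+ m) 0)) (toℚᵘ-fromℚᵘ (ℚᵘ.mkℚᵘ (+ n) 0)) ⟨
  toℚᵘ (ι m) ℚᵘ.* toℚᵘ (ι n)
    ≈⟨ toℚᵘ-homo-* (ι m) (ι n) ⟨
  toℚᵘ (ι m * ι n)                           ∎)
  where open import Relation.Binary.Reasoning.Setoid ℚᵘ.≃-setoid

ι-inverse : ∀ n .{{_ : ℕ.NonZero n}} → ι n * (+ 1 / n) ≡ 1ℚ
ι-inverse (suc n) = toℚᵘ-injective (begin
  toℚᵘ (ι (suc n) * (+ 1 / suc n))
    ≈⟨ toℚᵘ-homo-* (ι (suc n)) (+ 1 / suc n) ⟩
  toℚᵘ (ι (suc n)) ℚᵘ.* toℚᵘ (+ 1 / suc n)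
    ≈⟨ ℚᵘ.*-cong (toℚᵘ-fromℚᵘ (ℚᵘ.mkℚᵘ (+ suc n) 0)) (toℚᵘ-fromℚᵘ (ℚᵘ.mkℚᵘ (+ 1) n)) ⟩
  ℚᵘ.mkℚᵘ (+ suc n) 0 ℚᵘ.* ℚᵘ.mkℚᵘ (+ 1) n
    ≈⟨ ℚᵘ.*≡* (solve 1 (λ a → (a :* con (+ 1)) :* con (+ 1) := con (+ 1) :* (con (+ 1) :* a)) refl (+ suc n)) ⟩
  ℚᵘ.1ℚᵘ                                     ∎)
  where
  open import Relation.Binary.Reasoning.Setoid ℚᵘ.≃-setoid
  open ℤ.+-*-Solver

0≤ι : ∀ n → 0ℚ ≤ ι n
0≤ι n = nonNegative⁻¹ (ι n) {{normalize-nonNeg n 1}}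

ι-mono-≤ : ∀ {m n} → m ℕ.≤ n → ι m ≤ ι n
ι-mono-≤ {m} m≤n with k , refl ← ℕ.m≤n⇒∃[o]m+o≡n m≤n = begin
  ι m            ≡⟨ +-identityʳ (ι m) ⟨
  ι m + 0ℚ       ≤⟨ +-monoʳ-≤ (ι m) (0≤ι k) ⟩
  ι m + ι k      ≡⟨ ι-+ m k ⟨
  ι (m ℕ.+ k)    ∎
  where open ≤-Reasoning

-- Finite sums of rationals.

∑ : (X → ℚ) → List X → ℚ
∑ f xs = foldr _+_ 0ℚ (map f xs)

∑-mono : ∀ {f g : X → ℚ} xs → (∀ {x} → x ∈ xs → f x ≤ g x) → ∑ f xs ≤ ∑ g xs
∑-mono []       f≤g = ≤-refl
∑-mono (x ∷ xs) f≤g = +-mono-≤ (f≤g (here refl)) (∑-mono xs (f≤g ∘ there))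

0≤∑ : ∀ {f : X → ℚ} xs → (∀ x → 0ℚ ≤ f x) → 0ℚ ≤ ∑ f xs
0≤∑ []       0≤f = ≤-refl
0≤∑ (x ∷ xs) 0≤f = +-mono-≤ (0≤f x) (0≤∑ xs 0≤f)

∑-++ : ∀ (f : X → ℚ) xs ys → ∑ f (xs ++ ys) ≡ ∑ f xs + ∑ f ys
∑-++ f []       ys = sym (+-identityˡ _)
∑-++ f (x ∷ xs) ys = trans (cong (_+_ (f x)) (∑-++ f xs ys)) (sym (+-assoc (f x) _ _))

∑-map : ∀ (f : Y → ℚ) (g : X → Y) xs → ∑ f (map g xs) ≡ ∑ (f ∘ g) xs
∑-map f g xs = cong (foldr _+_ 0ℚ) (sym (map-∘ xs))

∑-concatMap : ∀ (f : Y → ℚ) (g : X → List Y) xs → ∑ f (concatMap g xs) ≡ ∑ (∑ f ∘ g) xs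
∑-concatMap f g []       = refl
∑-concatMap f g (x ∷ xs) = trans (∑-++ f (g x) _) (cong (_+_ (∑ f (g x))) (∑-concatMap f g xs))

∑-*ˡ : ∀ c (f : X → ℚ) xs → ∑ (λ x → c * f x) xs ≡ c * ∑ f xs
∑-*ˡ c f []       = sym (*-zeroʳ c)
∑-*ˡ c f (x ∷ xs) = trans (cong (_+_ (c * f x)) (∑-*ˡ c f xs)) (sym (*-distribˡ-+ c (f x) (∑ f xs)))

∑-ι : ∀ (f : X → ℕ) xs → ∑ (ι ∘ f) xs ≡ ι (sum (map f xs))
∑-ι f []       = refl
∑-ι f (x ∷ xs) = trans (cong (_+_ (ι (f x))) (∑-ι f xs)) (sym (ι-+ (f x) _))

∑-cartesianProductWith : ∀ (f : Z → ℚ) (h : X → Y → Z) xs ys →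
  ∑ f (cartesianProductWith h xs ys) ≡ ∑ (λ x → ∑ (λ y → f (h x y)) ys) xs
∑-cartesianProductWith f h []       ys = refl
∑-cartesianProductWith f h (x ∷ xs) ys = trans (∑-++ f (map (h x) ys) _)
  (cong₂ _+_ (∑-map f (h x) ys) (∑-cartesianProductWith f h xs ys))

∑-product : ∀ (f : X → ℚ) (g : Y → ℚ) xs ys → ∑ (λ x → ∑ (λ y → f x * g y) ys) xs ≡ ∑ f xs * ∑ g ys
∑-product f g []       ys = sym (*-zeroˡ (∑ g ys))
∑-product f g (x ∷ xs) ys = trans
  (cong₂ _+_ (∑-*ˡ (f x) g ys) (∑-product f g xs ys)) (sym (*-distribʳ-+ (∑ g ys) (f x) _))

∑-↭ : ∀ (f : X → ℚ) {xs ys} → xs ↭ ys → ∑ f xs ≡ ∑ f ys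
∑-↭ f p = foldr-commMonoid (setoid ℚ) +-0-isCommutativeMonoid (↭⇒↭ₛ (↭.map⁺ f p))

∑-unique-⊆ : ∀ {f : X → ℚ} {xs ys} → (∀ x → 0ℚ ≤ f x) → Unique xs → (∀ {x} → x ∈ xs → x ∈ ys) → ∑ f xs ≤ ∑ f ys
∑-unique-⊆ {f = f} {xs} {ys} 0≤f xs! xs⊆ys with zs , p ← unique-⊆⇒↭ xs! xs⊆ys = begin
  ∑ f xs              ≡⟨ +-identityʳ _ ⟨
  ∑ f xs + 0ℚ         ≤⟨ +-monoʳ-≤ (∑ f xs) (0≤∑ zs 0≤f) ⟩
  ∑ f xs + ∑ f zs     ≡⟨ ∑-++ f xs zs ⟨
  ∑ f (xs ++ zs)      ≡⟨ ∑-↭ f p ⟨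
  ∑ f ys              ∎
  where open ≤-Reasoning

AllPairs-resp-⊆ : ∀ {R : X → X → Set} {xs ys} → xs ⊆ ys → AllPairs R ys → AllPairs R xs
AllPairs-resp-⊆ []           []          = []
AllPairs-resp-⊆ (_ ∷ʳ xs⊆)   (_ ∷ Rys)   = AllPairs-resp-⊆ xs⊆ Rys
AllPairs-resp-⊆ (refl ∷ xs⊆) (Rx ∷ Rys)  = All-resp-⊆ xs⊆ Rx ∷ AllPairs-resp-⊆ xs⊆ Rys

-- The inductive bound on sums over arrangements, and the expectation.

module _ {y r c : ℚ} (0≤y : 0ℚ ≤ y) (0≤r : 0ℚ ≤ r) (0≤c : 0ℚ ≤ c)
         (w : ℕ → ℕ) (M : ℕ) (cM≡1 : c * ι M ≡ 1ℚ)
         (w-diagonal : ∀ n → diagonal (square w) (suc n) ℕ.≤ M ℕ.* (suc (suc n) ℕ.* w (suc (suc n)))) where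

  -- As c = 1 / M, this is n! (w n / M) r^(n + 1). The exponent n + 1 absorbs the powers of r: the
  -- bounds at k and l multiply to r^(k + l + 2), the power occurring at k + l + 1.
  bound : ℕ → ℚ
  bound n = c * ι (n ! ℕ.* w n) * r ^ suc n

  bound-* : ∀ k l → bound k * bound l ≡ c * c * r ^ suc (suc (k ℕ.+ l)) * ι (k ! ℕ.* l ! ℕ.* square w k l)
  bound-* k l = begin
    bound k * bound l
      ≡⟨ solve 5 (λ c a b p q → (c :* a :* p) :* (c :* b :* q) := c :* c :* (p :* q) :* (a :* b)) refl
           c (ι (k ! ℕ.* w k)) (ι (l ! ℕ.* w l)) (r ^ suc k) (r ^ suc l) ⟩
    c * c * (r ^ suc k * r ^ suc l) * (ι (k ! ℕ.* w k) * ι (l ! ℕ.* w l))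
      ≡⟨ cong₂ (λ p a → c * c * p * a)
           (trans (cong (r ^_) (sym (cong suc (ℕ.+-suc k l)))) (^-homo-* r (suc k) (suc l)))
           (trans (cong ι (ℕsolve 4 (λ a b s t → a ⊗ b ⊗ (s ⊗ t) ⊜ (a ⊗ s) ⊗ (b ⊗ t)) refl (k !) (l !) (w k) (w l)))
             (ι-* (k ! ℕ.* w k) (l ! ℕ.* w l))) ⟨
    c * c * r ^ suc (suc (k ℕ.+ l)) * ι (k ! ℕ.* l ! ℕ.* square w k l) ∎
    where
    open ≡-Reasoning
    open +-*-Solver
    open ℕ.+-*-Solver using () renaming (solve to ℕsolve; _:*_ to _⊗_; _:=_ to _⊜_)

  -- Applying `w-diagonal` produces the factors M and m + 2: the first cancels one c, the second
  -- turns (m + 1)! into (m + 2)!.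
  diagonal-step : ∀ m → c * c * r ^ suc (suc (suc m)) * ι (suc m ! ℕ.* diagonal (square w) (suc m)) ≤ bound (suc (suc m))
  diagonal-step m = begin
    c * c * ρ * ι (suc m ! ℕ.* diagonal (square w) (suc m))
      ≤⟨ *-monoˡ-≤-nonNeg (c * c * ρ) {{nonNegative (0≤* (0≤* 0≤c 0≤c) (0≤^ (suc (suc (suc m))) 0≤r))}}
           (ι-mono-≤ (ℕ.*-monoʳ-≤ (suc m !) (w-diagonal m))) ⟩
    c * c * ρ * ι (suc m ! ℕ.* (M ℕ.* (suc (suc m) ℕ.* w (suc (suc m)))))
      ≡⟨ cong (λ a → c * c * ρ * a) (trans
           (cong ι (ℕsolve 4 (λ f M s t → f ⊗ (M ⊗ (s ⊗ t)) ⊜ M ⊗ ((s ⊗ f) ⊗ t)) refl (suc m !) M (suc (suc m)) (w (suc (suc m)))))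
           (ι-* M (suc (suc m) ! ℕ.* w (suc (suc m))))) ⟩
    c * c * ρ * (ι M * b)
      ≡⟨ solve 4 (λ c ρ M a → c :* c :* ρ :* (M :* a) := (c :* M) :* (c :* a :* ρ)) refl c ρ (ι M) b ⟩
    c * ι M * bound (suc (suc m))
      ≡⟨ cong (_* bound (suc (suc m))) cM≡1 ⟩
    1ℚ * bound (suc (suc m))
      ≡⟨ *-identityˡ _ ⟩
    bound (suc (suc m)) ∎
    where
    open ≤-Reasoning
    open +-*-Solver
    open ℕ.+-*-Solver using () renaming (solve to ℕsolve; _:*_ to _⊗_; _:=_ to _⊜_)
    ρ = r ^ suc (suc (suc m))
    b = ι (suc (suc m) ! ℕ.* w (suc (suc m)))

  module _ (base₀ : 1ℚ ≤ bound 0) (base₁ : y ^ 2 ≤ bound 1) where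

    y^ext : ∀ {k} → List (Fin k) → ℚ
    y^ext u = y ^ ext u

    -- Sortedness makes the head the minimum, so the sum over each split factors and the induction
    -- hypothesis applies to both halves. Summing over the splits then produces the convolution.
    ∑-arrangements : ∀ {k} n (xs : List (Fin k)) → AllPairs Fin._<_ xs → length xs ℕ.≤ n →
                     ∑ y^ext (arrangements n xs) ≤ bound (length xs)
    ∑-arrangements zero    []  _ _ = ≤-trans (≤-reflexive (+-identityʳ 1ℚ)) base₀
    ∑-arrangements (suc n) []  _ _ = ≤-trans (≤-reflexive (+-identityʳ 1ℚ)) base₀
    -- A single entry has `ext` 2, a case outside `ext-split`. The length bound is split into two
    -- cases so that `arrangements` of the empty list reduces.
    ∑-arrangements (suc zero)    (x ∷ []) _ _ = ≤-trans (≤-reflexive (+-identityʳ (y ^ 2))) base₁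
    ∑-arrangements (suc (suc n)) (x ∷ []) _ _ = ≤-trans (≤-reflexive (+-identityʳ (y ^ 2))) base₁
    ∑-arrangements {k} (suc n) (x ∷ xs@(_ ∷ xs′)) (x<xs ∷ sorted) (s≤s len) = begin
      ∑ y^ext (arrangements (suc n) (x ∷ xs))
        ≡⟨ ∑-concatMap y^ext pieces (splits xs) ⟩
      ∑ (∑ y^ext ∘ pieces) (splits xs)
        ≤⟨ ∑-mono (splits xs) ∑-pieces ⟩
      ∑ (λ s → K * ι (h s)) (splits xs)
        ≡⟨ ∑-*ˡ K (ι ∘ h) (splits xs) ⟩
      K * ∑ (ι ∘ h) (splits xs)
        ≡⟨ cong (K *_) (trans (∑-ι h (splits xs)) (cong ι (splitSum-factorials (square w) xs))) ⟩
      K * ι (length xs ! ℕ.* diagonal (square w) (length xs))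
        ≤⟨ diagonal-step (length xs′) ⟩
      bound (length (x ∷ xs)) ∎
      where
      open ≤-Reasoning
      K = c * c * r ^ suc (suc (length xs))

      pieces : List (Fin k) × List (Fin k) → List (List (Fin k))
      pieces (us , vs) = cartesianProductWith (λ u v → u ++ x ∷ v) (arrangements n us) (arrangements n vs)

      h : List (Fin k) × List (Fin k) → ℕ
      h (us , vs) = length us ! ℕ.* length vs ! ℕ.* square w (length us) (length vs)

      ∑-pieces : ∀ {s} → s ∈ splits xs → ∑ y^ext (pieces s) ≤ K * ι (h s)
      ∑-pieces {us , vs} s∈ with us⊆ , vs⊆ , eq ← splits-sublists xs s∈ = begin
        ∑ y^ext (pieces (us , vs))
          ≡⟨ ∑-cartesianProductWith y^ext (λ u v → u ++ x ∷ v) Us Vs ⟩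
        ∑ (λ u → ∑ (λ v → y^ext (u ++ x ∷ v)) Vs) Us
          -- The factorisation holds for members of the two lists, and `∑-mono` is what supplies
          -- membership.
          ≤⟨ ∑-mono Us (λ u∈ → ∑-mono Vs (λ v∈ → ≤-reflexive (y^ext-split u∈ v∈))) ⟩
        ∑ (λ u → ∑ (λ v → y^ext u * y^ext v) Vs) Us
          ≡⟨ ∑-product y^ext y^ext Us Vs ⟩
        ∑ y^ext Us * ∑ y^ext Vs
          ≤⟨ *-mono-≤-nonNeg (0≤∑ Us (λ u → 0≤^ (ext u) 0≤y)) (0≤∑ Vs (λ v → 0≤^ (ext v) 0≤y))
               (∑-arrangements n us (AllPairs-resp-⊆ us⊆ sorted) us≤n)
               (∑-arrangements n vs (AllPairs-resp-⊆ vs⊆ sorted) vs≤n) ⟩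
        bound (length us) * bound (length vs)
          ≡⟨ bound-* (length us) (length vs) ⟩
        c * c * r ^ suc (suc (length us ℕ.+ length vs)) * ι (h (us , vs))
          ≡⟨ cong (λ l → c * c * r ^ suc (suc l) * ι (h (us , vs))) eq ⟩
        K * ι (h (us , vs)) ∎
        where
        us≤n = ℕ.≤-trans (ℕ.m+n≤o⇒m≤o (length us) (ℕ.≤-reflexive eq)) len
        vs≤n = ℕ.≤-trans (ℕ.m+n≤o⇒n≤o (length us) (ℕ.≤-reflexive eq)) len
        Us = arrangements n us
        Vs = arrangements n vs
        y^ext-split : ∀ {u v} → u ∈ Us → v ∈ Vs → y^ext (u ++ x ∷ v) ≡ y^ext u * y^ext v
        y^ext-split {u} {v} u∈ v∈ = trans
          (cong (y ^_) (ext-split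
            (arrangements-All n (All-resp-⊆ us⊆ x<xs) u∈)
            (arrangements-All n (All-resp-⊆ vs⊆ x<xs) v∈)
            nonempty))
          (^-homo-* y (ext u) (ext v))
          where
          nonempty : 1 ℕ.≤ length u ℕ.+ length v
          nonempty = subst (1 ℕ.≤_) (sym (trans
            (cong₂ ℕ._+_ (arrangements-length n us≤n u∈) (arrangements-length n vs≤n v∈)) eq)) (s≤s z≤n)

    𝔼-bound : 1ℚ ≤ y → ∀ {W} → (∀ n → w n ℕ.≤ W) → ∀ n →
              𝔼 n (λ π → y ^ R π) ≤ y * c * ι W * r * r ^ n
    𝔼-bound 1≤y {W} w≤W n = begin
      ∑ (λ π → y ^ R π) perms * 1/len
        ≤⟨ *-monoʳ-≤-nonNeg 1/len {{normalize-nonNeg 1 len}} (begin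
          ∑ (λ π → y ^ R π) perms
            -- The 1 in `R≤1+ext` costs a single factor y.
            ≤⟨ ∑-mono perms (λ {π} _ → ^-monoʳ-≤ 1≤y (R≤1+ext π)) ⟩
          ∑ (λ π → y * y^ext (word π)) perms
            ≡⟨ ∑-*ˡ y (y^ext ∘ word) perms ⟩
          y * ∑ (y^ext ∘ word) perms
            ≡⟨ cong (y *_) (∑-map y^ext word perms) ⟨
          y * ∑ y^ext (map word perms)
            ≤⟨ y*-mono (∑-unique-⊆ (λ u → 0≤^ (ext u) 0≤y) (Unique.map⁺ word-injective (permutations-unique n)) word∈) ⟩
          y * ∑ y^ext (arrangements n (allFin n))
            ≤⟨ y*-mono (∑-arrangements n (allFin n) (AllPairs.tabulate⁺-< id) (ℕ.≤-reflexive length-allFin)) ⟩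
          y * bound (length (allFin n))
            ≡⟨ cong (λ m → y * bound m) length-allFin ⟩
          y * (c * ι (n ! ℕ.* w n) * r ^ suc n)
            -- Replacing `n !` by the larger `len` lets the denominator of the mean cancel.
            ≤⟨ y*-mono (*-monoʳ-≤-nonNeg (r ^ suc n) {{nonNegative (0≤^ (suc n) 0≤r)}}
                 (*-monoˡ-≤-nonNeg c {{nonNegative 0≤c}}
                   (ι-mono-≤ (ℕ.*-mono-≤ (n!≤length-permutations n) (w≤W n))))) ⟩
          y * (c * ι (len ℕ.* W) * r ^ suc n)
            ≡⟨ cong (λ a → y * (c * a * r ^ suc n)) (ι-* len W) ⟩
          y * (c * (ι len * ι W) * r ^ suc n) ∎) ⟩
      y * (c * (ι len * ι W) * r ^ suc n) * 1/len
        ≡⟨ solve 7 (λ y c l w r p i → y :* (c :* (l :* w) :* (r :* p)) :* i := y :* c :* w :* r :* p :* (l :* i))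
             refl y c (ι len) (ι W) r (r ^ n) 1/len ⟩
      y * c * ι W * r * r ^ n * (ι len * 1/len)
        ≡⟨ trans (cong (y * c * ι W * r * r ^ n *_) (ι-inverse len)) (*-identityʳ _) ⟩
      y * c * ι W * r * r ^ n ∎
      where
      open ≤-Reasoning
      open +-*-Solver
      perms = permutations n
      len = length perms
      instance _ = permutations-nonZero n
      1/len = + 1 / len

      y*-mono : ∀ {p q} → p ≤ q → y * p ≤ y * q
      y*-mono = *-monoˡ-≤-nonNeg y {{nonNegative 0≤y}}

      length-allFin : length (allFin n) ≡ n
      length-allFin = length-tabulate {n = n} id

      word∈ : ∀ {u} → u ∈ map word perms → u ∈ arrangements n (allFin n)
      word∈ u∈ with π , π∈ , refl ← ∈-map⁻ word u∈ =
        arrangements-complete n (ℕ.≤-reflexive length-allFin)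
          (word-↭ π (proj₂ (∈-filter⁻ isPermutation? {xs = words n (allFin n)} π∈)))

theorem3p29 : ∃ λ (C : ℚ) → ∀ (n : ℕ) → 2 ℕ.≤ n →
    𝔼 n (λ π → (+ 1784 / 1000) ^ R π) ≤ C * (+ 1515 / 1000) ^ n
-- The constant is y c 3467 r, where 3467 is the largest value of `W` and the last factor r comes
-- from the exponent n + 1 in `bound`.
theorem3p29 = + 1784 / 1000 * (+ 1 / 2500) * ι 3467 * (+ 1515 / 1000) , λ n _ → 𝔼-bound
  {y = + 1784 / 1000} {r = + 1515 / 1000} {c = + 1 / 2500}
  (from-yes (0ℚ ≤? + 1784 / 1000)) (from-yes (0ℚ ≤? + 1515 / 1000)) (from-yes (0ℚ ≤? + 1 / 2500))
  W 2500 refl W-diagonal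
  -- The two base cases are nearly tight: 1 against 1.000506, and 3.182656 against about 3.18302.
  (from-yes (1ℚ ≤? + 1 / 2500 * ι (0 ! ℕ.* W 0) * (+ 1515 / 1000) ^ 1))
  (from-yes ((+ 1784 / 1000) ^ 2 ≤? + 1 / 2500 * ι (1 ! ℕ.* W 1) * (+ 1515 / 1000) ^ 2))
  (from-yes (1ℚ ≤? + 1784 / 1000))
  W≤3467 n
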